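{- Let $(\Gamma,N)$ and $(\Gamma',N')$ be equivalent link-regular numbered graphs. Then $\mathrm{NGP}(\Gamma,N)$ and $\mathrm{NGP}(\Gamma',N')$, each with respect to its standard generating set, have the same geodesic growth series.
   Context: A numbered graph $(\Gamma,N)$ is a finite simplicial graph $\Gamma$ (vertex set $V\Gamma$, edge set $E\Gamma$) together with a map $N: V\Gamma\to\{2,3,4,\dots\}$. The numbered graph product $\mathrm{NGP}(\Gamma,N)$ is the group with presentation $\langle v\in V\Gamma \mid v^{N(v)}=1 \text{ for all } v,\ uv=vu \text{ for all } \{u,v\}\in E\Gamma\rangle$. Its standard generating set is $S=V\Gamma\cup(V\Gamma)^{ -1}$ (when $N(v)=2$, $v^{ -1}=v$ is a single element of $S$). A word over $S$ is a geodesic if no shorter word over $S$ represents the same group element; the geodesic growth series is $\sum_{n\ge0} a_n z^n$ where $a_n$ is the number of geodesic words of length $n$. A clique is a subset $\sigma\subseteq V\Gamma$ spanning a complete subgraph (the empty set is a clique); its link is $\mathrm{Lk}(\sigma)=\{v\in V\Gamma\setminus\sigma \mid \sigma\cup\{v\}\text{ is a clique}\}$. For $U\subseteq V\Gamma$, $N(U)$ denotes the multiset $\{N(v)\mid v\in U\}$. $(\Gamma,N)$ is link-regular if for all cliques $\sigma_1,\sigma_2$ of $\Gamma$ with $N(\sigma_1)=N(\sigma_2)$ one has $N(\mathrm{Lk}(\sigma_1))=N(\mathrm{Lk}(\sigma_2))$. Two link-regular numbered graphs $(\Gamma,N)$, $(\Gamma',N')$ are equivalent if (i) $N(V\Gamma)=N'(V\Gamma')$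 as multisets, and (ii) whenever cliques $\sigma\subseteq V\Gamma$, $\sigma'\subseteq V\Gamma'$ satisfy $N(\sigma)=N'(\sigma')$, one has $N(\mathrm{Lk}(\sigma))=N'(\mathrm{Lk}(\sigma'))$. -}

module Defs where

open import Data.Nat using (ℕ; zero; suc; _+_; _≤_; _≡ᵇ_)
open import Data.Bool using (Bool; true; false; T; not; _∧_; _∨_; if_then_else_)
open import Data.Fin using (Fin; zero; suc)
open import Data.Vec using (Vec; lookup; tabulate)
open import Data.List using (List; []; _∷_; _++_; length; replicate)
open import Data.List.Membership.Propositional using (_∈_)
open import Data.List.Relation.Unary.Unique.Propositional using (Unique)
open import Data.Product using (_×_)
open import Relation.Binary.PropositionalEquality using (_≡_; _≢_)

record NumberedGraph : Set where
  field
    k      : ℕ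
    adj    : Fin k → Fin k → Bool
    adj-sym : ∀ u v → adj u v ≡ adj v u
    adj-irr : ∀ v → adj v v ≡ false
    N      : Fin k → ℕ
    N≥2    : ∀ v → 2 ≤ N v

open NumberedGraph public

VSet : NumberedGraph → Set
VSet G = Vec Bool (k G)

_∈ᵥ_ : {G : NumberedGraph} → Fin (k G) → VSet G → Set
v ∈ᵥ σ = T (lookup σ v)

allFin : (n : ℕ) → (Fin n → Bool) → Bool
allFin zero    p = true
allFin (suc n) p = p zero ∧ allFin n (λ i → p (suc i))

countFin : (n : ℕ) → (Fin n → Bool) → ℕ
countFin zero    p = 0
countFin (suc n) p = (if p zero then 1 else 0) + countFin n (λ i → p (suc i))

fullSet : (G : NumberedGraph) → VSet G
fullSet G = tabulate (λ _ → true)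

IsClique : (G : NumberedGraph) → VSet G → Set
IsClique G σ = ∀ u v → _∈ᵥ_ {G} u σ → _∈ᵥ_ {G} v σ → u ≢ v → T (adj G u v)

-- Lk(σ) = { v ∉ σ | σ ∪ {v} is a clique } (for σ a clique)
Lk : (G : NumberedGraph) → VSet G → VSet G
Lk G σ = tabulate (λ v → not (lookup σ v) ∧ allFin (k G) (λ u → not (lookup σ u) ∨ adj G u v))

mult : (G : NumberedGraph) → VSet G → ℕ → ℕ
mult G U m = countFin (k G) (λ v → lookup U v ∧ (N G v ≡ᵇ m))

SameNMultiset : (G : NumberedGraph) → VSet G → (G' : NumberedGraph) → VSet G' → Set
SameNMultiset G U G' U' = ∀ m → mult G U m ≡ mult G' U' m

LinkRegular : NumberedGraph → Set
LinkRegular G = ∀ σ₁ σ₂ → IsClique G σ₁ → IsClique G σ₂ →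
  SameNMultiset G σ₁ G σ₂ → SameNMultiset G (Lk G σ₁) G (Lk G σ₂)

Equivalent : NumberedGraph → NumberedGraph → Set
Equivalent G G' =
  SameNMultiset G (fullSet G) G' (fullSet G') ×
  (∀ σ σ' → IsClique G σ → IsClique G' σ' →
     SameNMultiset G σ G' σ' → SameNMultiset G (Lk G σ) G' (Lk G' σ'))

-- Standard generating set S = V ∪ V⁻¹; v⁻¹ is a separate letter only if N(v) ≠ 2.
data Letter (G : NumberedGraph) : Set where
  pos : Fin (k G) → Letter G
  neg : (v : Fin (k G)) → T (not (N G v ≡ᵇ 2)) → Letter G

Word : NumberedGraph → Set
Word G = List (Letter G)

-- Defining relations of NGP(Γ,N) as a monoid presentation over S:
-- s s⁻¹ = 1, s⁻¹ s = 1, v^{N(v)} = 1, uv = vu for edges {u,v}.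
data Relator (G : NumberedGraph) : Word G → Word G → Set where
  power : ∀ v → Relator G (replicate (N G v) (pos v)) []
  invR  : ∀ v p → Relator G (pos v ∷ neg v p ∷ []) []
  invL  : ∀ v p → Relator G (neg v p ∷ pos v ∷ []) []
  comm  : ∀ u v → T (adj G u v) → Relator G (pos u ∷ pos v ∷ []) (pos v ∷ pos u ∷ [])

data Same (G : NumberedGraph) : Word G → Word G → Set where
  ≈-step  : ∀ xs {l r} ys → Relator G l r → Same G (xs ++ l ++ ys) (xs ++ r ++ ys)
  ≈-refl  : ∀ {w} → Same G w w
  ≈-sym   : ∀ {u w} → Same G u w → Same G w u
  ≈-trans : ∀ {u v w} → Same G u v → Same G v w → Same G u w

IsGeodesic : (G : NumberedGraph) → Word G → Set
IsGeodesic G w = ∀ u → Same G u w → length w ≤ length u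

EnumeratesGeodesics : (G : NumberedGraph) → ℕ → List (Word G) → Set
EnumeratesGeodesics G n L =
  Unique L ×
  (∀ w → (w ∈ L → (length w ≡ n × IsGeodesic G w)) ×
         ((length w ≡ n × IsGeodesic G w) → w ∈ L))

-- Same geodesic growth series: for every n, the numbers a_n of geodesic words of
-- length n coincide (any two enumerations have the same length).
SameGeodesicGrowth : NumberedGraph → NumberedGraph → Set
SameGeodesicGrowth G G' = ∀ n (L : List (Word G)) (L' : List (Word G')) →
  EnumeratesGeodesics G n L → EnumeratesGeodesics G' n L' → length L ≡ length L'

{-# OPTIONS --safe #-}
module Submission where

-- A group element is recorded by its piling: the heap of its syllables, seen as one stack per
-- vertex. Turning a piling by v^j is an action of the group, so pilings are invariants, and the
-- sum of the lengths of the syllables of a piling is the word length of the element. A word is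
-- therefore geodesic iff each of its letters lengthens the top syllable of its own vertex, and
-- what may follow depends only on the top syllables, whose vertices span a clique σ. A new
-- letter v keeps the syllables on σ ∩ Lk(v). The number of vertices v with a given N(v) and a
-- given trace on σ follows from the numbers N(Lk(τ)), τ ⊆ σ, by inclusion-exclusion; hence
-- equivalent graphs admit equally many continuations.

open import Algebra.Bundles using (CommutativeMonoid)
open import Data.Bool using (Bool; true; false; T; not; _∧_; _∨_; if_then_else_)
open import Data.Bool.ListAction using (any; all)
open import Data.Bool.Properties
  using (T-irrelevant; ∧-identityʳ; ∧-zeroʳ; ∨-distribʳ-∧; ∧-commutativeMonoid; ∨-∧-booleanAlgebra)
open import Data.Fin using (Fin; zero; suc; punchIn)
open import Data.Fin.Properties using (_≟_; suc-injective)
open import Data.List as List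
  using (List; []; _∷_; _++_; [_]; length; replicate; drop; map; filter; concatMap)
open import Data.List.Membership.Propositional using (_∈_; _∉_; lose; find)
open import Data.List.Membership.Propositional.Properties
  using (∈-concatMap⁺; ∈-concatMap⁻; ∈-map⁺; ∈-map⁻; ∈-filter⁺; ∈-allFin)
open import Data.List.Membership.Propositional.Properties.WithK using (unique∧set⇒bag)
open import Data.List.Properties
  using (≡-dec; ∷-injectiveˡ; ∷-injectiveʳ; ++-assoc; ++-identityʳ; length-++; length-map; length-replicate)
open import Data.List.Relation.Binary.BagAndSetEquality using (∼bag⇒↭)
open import Data.List.Relation.Binary.Disjoint.Propositional using (Disjoint)
open import Data.List.Relation.Binary.Permutation.Propositional.Properties using (↭-length)
open import Data.List.Relation.Binary.Pointwise as Pointwise using (Pointwise; []; _∷_; Pointwise-length)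
open import Data.List.Relation.Unary.All as All using (All; []; _∷_)
import Data.List.Relation.Unary.All.Properties as All
open import Data.List.Relation.Unary.AllPairs as AllPairs using (AllPairs; []; _∷_)
import Data.List.Relation.Unary.AllPairs.Properties as AllPairs
open import Data.List.Relation.Unary.Any using (here; there)
open import Data.List.Relation.Unary.Unique.Propositional using (Unique)
import Data.List.Relation.Unary.Unique.Propositional.Properties as Unique
open import Data.Nat as ℕ
  using (ℕ; zero; suc; _+_; _*_; _∸_; _⊓_; _%_; _/_; _≡ᵇ_; _≤_; _<_; z≤n; s≤s; NonZero; >-nonZero)
open import Data.Nat.DivMod
open import Data.Nat.Properties hiding (_≟_; suc-injective)
open import Data.Product using (∃; ∃-syntax; _×_; _,_; proj₁; proj₂)
open import Data.Product.Properties using (×-≡,≡→≡; ×-≡,≡←≡)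
open import Data.Sum using (_⊎_; inj₁; inj₂)
open import Data.Unit using (⊤)
open import Data.Vec using (lookup; tabulate)
open import Data.Vec.Properties using (lookup∘tabulate)
open import Function using (_∘_; _$_; id; mk⇔)
open import Relation.Binary.Definitions using (DecidableEquality)
open import Relation.Binary.PropositionalEquality
  using (_≡_; _≢_; _≗_; refl; sym; trans; cong; cong₂; subst; subst₂; module ≡-Reasoning)
open import Relation.Nullary using (Dec; does; yes; no; ¬_; contradiction)
open import Relation.Nullary.Decidable using (T?; dec-false; map′; _×-dec_)

open import Algebra.Lattice.Properties.BooleanAlgebra ∨-∧-booleanAlgebra using (deMorgan₂)
open import Algebra.Properties.CommutativeMonoid.Sum +-0-commutativeMonoid
  using (sum; sum-cong-≗; sum-replicate-zero; ∑-distrib-+; sum-remove)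
open import Algebra.Properties.CommutativeSemigroup +-commutativeSemigroup using (x∙yz≈y∙xz)
open import Algebra.Properties.CommutativeSemigroup (CommutativeMonoid.commutativeSemigroup ∧-commutativeMonoid)
  using () renaming (interchange to ∧-interchange)

open import Defs

-- There need be no map between the two graphs that respects adjacency, so the geodesics cannot be
-- matched through one fixed bijection of vertices. Instead vertices are paired anew before every
-- letter: for two pilings in corresponding states, those with the same number and the same trace on
-- the top clique are paired, which is possible because their counts agree. Paired letters are both
-- raising or both not, and raising ones lead to corresponding states again.
--
-- The state may forget all that lies below the tops, because a raising letter never cancels a
-- syllable: residue 0 has cost 0, which is not a successor. Hence no turn along a geodesic uncovers
-- an older entry.
--
-- That `norm` is the word length needs two bounds. One letter raises it by at most 1, so no word is
-- shorter than the norm of the piling that it runs to; and spelling each syllable by the shorter of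
-- its two powers gives a word of exactly that length.

data Position : Set where
  same near far : Position

top : List ℕ → ℕ
top []      = 0
top (e ∷ _) = e

-- A syllable v^e pushes e on the stack of v and the marker 0 on the stacks of the vertices that
-- v does not commute with; entries are residues, so a genuine exponent is never 0.
place : ℕ → Position → List ℕ → List ℕ
place zero    _    s = s
place (suc e) same s = suc e ∷ s
place (suc e) near s = s
place (suc e) far  s = 0 ∷ s

unplace : ℕ → Position → List ℕ → List ℕ
unplace zero    _    s = s
unplace (suc _) same s = drop 1 s
unplace (suc _) near s = s
unplace (suc _) far  s = drop 1 s

place-near : ∀ e s → place e near s ≡ s
place-near zero    s = refl
place-near (suc e) s = refl

unplace-near : ∀ e s → unplace e near s ≡ s
unplace-near zero    s = refl
unplace-near (suc e) s = refl

unplace-place : ∀ e q s → unplace e q (place e q s) ≡ s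
unplace-place zero    q    s = refl
unplace-place (suc e) same s = refl
unplace-place (suc e) near s = refl
unplace-place (suc e) far  s = refl

top-place-same : ∀ e {s} → top s ≡ 0 → top (place e same s) ≡ e
top-place-same zero    clear = clear
top-place-same (suc e) clear = refl

-- The length of v^e in a cyclic group of order n.
cost : ℕ → ℕ → ℕ
cost n e = e ⊓ (n ∸ e)

cost-suc : ∀ n e → cost n (suc e) ≤ suc (cost n e)
cost-suc n e = ⊓-monoʳ-≤ (suc e) (≤-trans (∸-monoʳ-≤ n (n≤1+n e)) (n≤1+n _))

cost-pred : ∀ n e → suc e < n → cost n e ≤ suc (cost n (suc e))
cost-pred (suc n) e (s≤s e<n) =
  ≤-trans (⊓-mono-≤ (n≤1+n e) ≤-refl)
    (⊓-glb (≤-trans (m⊓n≤m _ _) (n≤1+n _))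
           (≤-trans (m⊓n≤n (suc e) (suc n ∸ e)) (≤-reflexive (+-∸-assoc 1 (<⇒≤ e<n)))))

-- At `e + 1 = n` the residue wraps to 0, which costs nothing; elsewhere only the first argument of
-- the minimum grows, by 1.
cost-step-up : ∀ n e .{{_ : NonZero n}} → e < n → cost n ((e + 1) % n) ≤ suc (cost n e)
cost-step-up n@(suc _) e e<n rewrite +-comm e 1 with m≤n⇒m<n∨m≡n e<n
... | inj₁ 1+e<n rewrite m<n⇒m%n≡m 1+e<n = cost-suc n e
... | inj₂ refl  rewrite n%n≡0 n ⦃ _ ⦄   = z≤n

-- Adding `n - 1` is subtracting 1 modulo `n`. From `e = 0` it reaches `n - 1`, whose cost is at
-- most 1 through the second argument of the minimum.
cost-step-down : ∀ n e .{{_ : NonZero n}} → e < n → cost n ((e + (n ∸ 1)) % n) ≤ suc (cost n e)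
cost-step-down (suc m) zero    e<n rewrite m<n⇒m%n≡m (n<1+n m) =
  ≤-trans (m⊓n≤n m _) (≤-reflexive (m+n∸n≡m 1 m))
cost-step-down (suc m) (suc e) e<n
  rewrite sym (+-suc e m) | [m+n]%n≡m%n e (suc m) ⦃ _ ⦄ | m<n⇒m%n≡m (<-trans (n<1+n e) e<n) =
  cost-pred (suc m) e e<n

-- Finite sums and counting by fibres

sum-single : ∀ {n} {f : Fin n → ℕ} v → (∀ u → u ≢ v → f u ≡ 0) → sum f ≡ f v
sum-single {suc n} {f} zero    vanish = trans
  (cong (f zero +_) (trans (sum-cong-≗ (λ u → vanish (suc u) (λ ()))) (sum-replicate-zero n)))
  (+-identityʳ _)
sum-single {suc n} {f} (suc v) vanish = trans
  (cong (_+ sum (f ∘ suc)) (vanish zero (λ ())))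
  (sum-single v (λ u u≢v → vanish (suc u) (u≢v ∘ suc-injective)))

sum-vanishing : ∀ {n} {f : Fin n → ℕ} → (∀ v → f v ≡ 0) → sum f ≡ 0
sum-vanishing {n} vanish = trans (sum-cong-≗ vanish) (sum-replicate-zero n)

indicator : Bool → ℕ
indicator b = if b then 1 else 0

indicator-support : ∀ {n} (p : Fin n → Bool) → sum (indicator ∘ p) ≢ 0 → ∃[ i ] p i ≡ true
indicator-support {zero}  p nonzero = contradiction refl nonzero
indicator-support {suc n} p nonzero with p zero in eq
... | true  = zero , eq
... | false = let i , pi = indicator-support (p ∘ suc) nonzero in suc i , pi

witness : ∀ {P : Set} (P? : Dec P) → does P? ≡ true → P
witness (yes p) _ = p

module _ {K : Set} (_≟ᴷ_ : DecidableEquality K) where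

  fibreSize : ∀ {n} → (Fin n → K) → K → ℕ
  fibreSize key κ = sum (λ v → indicator (does (key v ≟ᴷ κ)))

  own-fibre : ∀ {n} (key : Fin (suc n) → K) → fibreSize key (key zero) ≢ 0
  own-fibre key eq with key zero ≟ᴷ key zero
  own-fibre key () | yes _
  ... | no ≢ = contradiction refl ≢

  -- Equal fibre sizes give a key-preserving bijection, built greedily: the first index is paired
  -- with some `i` of the same key, `punchIn i` removes it, and both fibre counts lose the same
  -- indicator, so the hypothesis survives.
  sum-transport : ∀ {n n'} (key : Fin n → K) (key' : Fin n' → K) {f : Fin n → ℕ} {f' : Fin n' → ℕ} →
    fibreSize key ≗ fibreSize key' → (∀ v v' → key v ≡ key' v' → f v ≡ f' v') → sum f ≡ sum f'
  sum-transport {zero}  {zero}  key key' fibres agree = refl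
  sum-transport {zero}  {suc _} key key' fibres agree = contradiction (sym (fibres (key' zero))) (own-fibre key')
  sum-transport {suc _} {zero}  key key' fibres agree = contradiction (fibres (key zero)) (own-fibre key)
  sum-transport {suc _} {suc _} key key' {f} {f'} fibres agree
    with i , hit ← indicator-support (λ v → does (key' v ≟ᴷ key zero))
                     (own-fibre key ∘ trans (fibres (key zero)))
    = trans (cong₂ _+_ (agree zero i same-key)
              (sum-transport (key ∘ suc) (key' ∘ punchIn i) fibres' (λ v v' → agree (suc v) (punchIn i v'))))
            (sym (sum-remove {i = i} f'))
    where
    same-key : key zero ≡ key' i
    same-key = sym (witness (key' i ≟ᴷ key zero) hit)
    fibres' : fibreSize (key ∘ suc) ≗ fibreSize (key' ∘ punchIn i)
    fibres' κ = +-cancelˡ-≡ (indicator (does (key zero ≟ᴷ κ))) _ _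
      (trans (fibres κ) (trans (sum-remove {i = i} (λ v → indicator (does (key' v ≟ᴷ κ))))
        (cong (λ x → indicator (does (x ≟ᴷ κ)) + fibreSize (key' ∘ punchIn i) κ) (sym same-key))))

-- Concatenated and guarded lists

length-concatMap-tabulate : ∀ {A B : Set} (f : A → List B) {n} (g : Fin n → A) →
  length (concatMap f (List.tabulate g)) ≡ sum (λ i → length (f (g i)))
length-concatMap-tabulate f {zero}  g = refl
length-concatMap-tabulate f {suc n} g = trans (length-++ (f (g zero)))
  (cong (length (f (g zero)) +_) (length-concatMap-tabulate f (g ∘ suc)))

concatMap-unique : ∀ {A B : Set} {f : A → List B} → (∀ x → Unique (f x)) →
  (∀ {x y z} → z ∈ f x → z ∈ f y → x ≡ y) → ∀ {xs} → Unique xs → Unique (concatMap f xs)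
concatMap-unique {f = f} unique determined xs! =
  Unique.concat⁺ (All.map⁺ (All.universal unique _)) (AllPairs.map⁺ (AllPairs.map disjoint xs!))
  where
  disjoint : ∀ {x y} → x ≢ y → Disjoint (f x) (f y)
  disjoint x≢y (z∈x , z∈y) = x≢y (determined z∈x z∈y)

keepIf : ∀ {P A : Set} → Dec P → List A → List A
keepIf (yes _) xs = xs
keepIf (no _)  xs = []

∈-keepIf⁻ : ∀ {P A : Set} (P? : Dec P) {x : A} {xs} → x ∈ keepIf P? xs → P × x ∈ xs
∈-keepIf⁻ (yes p) x∈ = p , x∈

∈-keepIf⁺ : ∀ {P A : Set} (P? : Dec P) {x : A} {xs} → P → x ∈ xs → x ∈ keepIf P? xs
∈-keepIf⁺ (yes _) p x∈ = x∈
∈-keepIf⁺ (no ¬p) p x∈ = contradiction p ¬p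

keepIf-unique : ∀ {P A : Set} (P? : Dec P) {xs : List A} → Unique xs → Unique (keepIf P? xs)
keepIf-unique (yes _) xs! = xs!
keepIf-unique (no _)  _   = []

length-keepIf : ∀ {P Q A B : Set} (P? : Dec P) (Q? : Dec Q) {xs : List A} {ys : List B} →
  (P → Q) → (Q → P) → (P → length xs ≡ length ys) → length (keepIf P? xs) ≡ length (keepIf Q? ys)
length-keepIf (yes p) (yes _) to from len = len p
length-keepIf (yes p) (no ¬q) to from len = contradiction (to p) ¬q
length-keepIf (no ¬p) (yes q) to from len = contradiction (from q) ¬p
length-keepIf (no _)  (no _)  to from len = refl

%-cong : ∀ {m m' n n'} .⦃ _ : NonZero n ⦄ .⦃ _ : NonZero n' ⦄ → m ≡ m' → n ≡ n' → m % n ≡ m' % n'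
%-cong refl refl = refl

indicator-shuffle : ∀ x y q z → indicator (x ∧ (y ∧ (q ∧ z))) ≡ indicator ((q ∧ x) ∧ (y ∧ z))
indicator-shuffle x     y     true  z = refl
indicator-shuffle false y     false z = refl
indicator-shuffle true  false false z = refl
indicator-shuffle true  true  false z = refl

_≟ᴾ_ : DecidableEquality Position
same ≟ᴾ same = yes refl
same ≟ᴾ near = no λ ()
same ≟ᴾ far  = no λ ()
near ≟ᴾ same = no λ ()
near ≟ᴾ near = yes refl
near ≟ᴾ far  = no λ ()
far  ≟ᴾ same = no λ ()
far  ≟ᴾ near = no λ ()
far  ≟ᴾ far  = yes refl

indicator-position : ∀ x y z q → indicator (x ∧ (y ∧ z)) ≡
  indicator (x ∧ (y ∧ (does (q ≟ᴾ same) ∧ z))) +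
    (indicator (x ∧ (y ∧ (does (q ≟ᴾ near) ∧ z))) + indicator (x ∧ (y ∧ (does (q ≟ᴾ far) ∧ z))))
indicator-position false y     z q    = refl
indicator-position true  false z q    = refl
indicator-position true  true  z same = sym (+-identityʳ _)
indicator-position true  true  z near = sym (+-identityʳ _)
indicator-position true  true  z far  = refl

module _ (G : NumberedGraph) where

  -- Relative position of two vertices

  position : Fin (k G) → Fin (k G) → Position
  position u v with u ≟ v | adj G u v
  ... | yes _ | _     = same
  ... | no _  | true  = near
  ... | no _  | false = far

  position-refl : ∀ v → position v v ≡ same
  position-refl v with v ≟ v
  ... | yes _  = refl
  ... | no v≢v = contradiction refl v≢v

  position-sym : ∀ u v → position u v ≡ position v u
  position-sym u v with u ≟ v | v ≟ u | adj G u v | adj G v u | adj-sym G u v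
  ... | yes _   | yes _   | _     | _     | _    = refl
  ... | yes u≡v | no v≢u  | _     | _     | _    = contradiction (sym u≡v) v≢u
  ... | no u≢v  | yes v≡u | _     | _     | _    = contradiction (sym v≡u) u≢v
  ... | no _    | no _    | true  | true  | refl = refl
  ... | no _    | no _    | false | false | refl = refl

  same⇒≡ : ∀ {u v} → position u v ≡ same → u ≡ v
  same⇒≡ {u} {v} eq with u ≟ v | adj G u v
  same⇒≡ eq | yes u≡v | _     = u≡v
  same⇒≡ () | no _    | true
  same⇒≡ () | no _    | false

  near⇒adj : ∀ {u v} → position u v ≡ near → adj G u v ≡ true
  near⇒adj {u} {v} eq with u ≟ v | adj G u v
  near⇒adj eq | no _ | true = refl

  near⇒≢ : ∀ {u v} → position u v ≡ near → u ≢ v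
  near⇒≢ {u} eq refl with () ← trans (sym eq) (position-refl u)

  adj⇒near : ∀ {u v} → adj G u v ≡ true → position u v ≡ near
  adj⇒near {u} {v} eq with u ≟ v | adj G u v in eq'
  adj⇒near eq | no _     | true = refl
  adj⇒near eq | yes refl | true with () ← trans (sym eq') (adj-irr G _)

  instance
    N-nonZero : ∀ {v} → NonZero (N G v)
    N-nonZero {v} = >-nonZero (≤-trans (s≤s z≤n) (N≥2 G v))

  -- Words and pilings

  ++-congˡ : ∀ z {u w} → Same G u w → Same G (z ++ u) (z ++ w)
  ++-congˡ z (≈-step xs {l} {r} ys rel) =
    subst₂ (Same G) (++-assoc z xs _) (++-assoc z xs _) (≈-step (z ++ xs) ys rel)
  ++-congˡ z ≈-refl        = ≈-refl
  ++-congˡ z (≈-sym p)     = ≈-sym (++-congˡ z p)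
  ++-congˡ z (≈-trans p q) = ≈-trans (++-congˡ z p) (++-congˡ z q)

  ++-congʳ : ∀ z {u w} → Same G u w → Same G (u ++ z) (w ++ z)
  ++-congʳ z (≈-step xs {l} {r} ys rel) =
    subst₂ (Same G) (assoc₃ l) (assoc₃ r) (≈-step xs (ys ++ z) rel)
    where
    assoc₃ : ∀ m → xs ++ m ++ ys ++ z ≡ (xs ++ m ++ ys) ++ z
    assoc₃ m = sym (trans (++-assoc xs (m ++ ys) z) (cong (xs ++_) (++-assoc m ys z)))
  ++-congʳ z ≈-refl        = ≈-refl
  ++-congʳ z (≈-sym p)     = ≈-sym (++-congʳ z p)
  ++-congʳ z (≈-trans p q) = ≈-trans (++-congʳ z p) (++-congʳ z q)

  ≡⇒Same : ∀ {u w} → u ≡ w → Same G u w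
  ≡⇒Same refl = ≈-refl

  relator : ∀ {l r} → Relator G l r → Same G l r
  relator {l} {r} rel = subst₂ (Same G) (++-identityʳ l) (++-identityʳ r) (≈-step [] [] rel)

  pow : Fin (k G) → ℕ → Word G
  pow v e = replicate e (pos v)

  pow-+ : ∀ v m n → pow v (m + n) ≡ pow v m ++ pow v n
  pow-+ v zero    n = refl
  pow-+ v (suc m) n = cong (pos v ∷_) (pow-+ v m n)

  pow-multiple : ∀ v q → Same G (pow v (q * N G v)) []
  pow-multiple v zero    = ≈-refl
  pow-multiple v (suc q) = ≈-trans (≡⇒Same (pow-+ v (N G v) _))
    (≈-trans (++-congʳ _ (relator (power v))) (pow-multiple v q))

  pow-% : ∀ v e → Same G (pow v e) (pow v (e % N G v))
  pow-% v e = ≈-trans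
    (≡⇒Same (trans (cong (pow v) (m≡m%n+[m/n]*n e (N G v))) (pow-+ v (e % N G v) _)))
    (≈-trans (++-congˡ (pow v (e % N G v)) (pow-multiple v (e / N G v)))
             (≡⇒Same (++-identityʳ _)))

  letter-pow-comm : ∀ {u v} → adj G u v ≡ true → ∀ n →
    Same G (pos u ∷ pow v n) (pow v n ++ [ pos u ])
  letter-pow-comm         eq zero    = ≈-refl
  letter-pow-comm {u} {v} eq (suc n) = ≈-trans
    (++-congʳ (pow v n) (relator (comm u v (subst T (sym eq) _))))
    (++-congˡ [ pos v ] (letter-pow-comm eq n))

  pow-comm : ∀ {u v} → adj G u v ≡ true → ∀ m n →
    Same G (pow u m ++ pow v n) (pow v n ++ pow u m)
  pow-comm eq zero    n = ≡⇒Same (sym (++-identityʳ _))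
  pow-comm {u} {v} eq (suc m) n = ≈-trans (++-congˡ [ pos u ] (pow-comm eq m n))
    (≈-trans (++-congʳ (pow u m) (letter-pow-comm eq n)) (≡⇒Same (++-assoc (pow v n) _ _)))

  Piling : Set
  Piling = Fin (k G) → List ℕ

  put : Fin (k G) → ℕ → Piling → Piling
  put v e Q u = place e (position v u) (Q u)

  residue : Fin (k G) → ℕ → Piling → ℕ
  residue v j P = (top (P v) + j) % N G v

  -- The top exponent at v counts as 0 when no v-syllable is on top, so that appending, merging
  -- and cancelling a syllable are all the same replacement.
  turn : Fin (k G) → ℕ → Piling → Piling
  turn v j P u = place (residue v j P) (position v u) (unplace (top (P v)) (position v u) (P u))

  put-cong : ∀ v e {P Q} → P ≗ Q → put v e P ≗ put v e Q
  put-cong v e eq u = cong (place e _) (eq u)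

  turn-cong : ∀ v j {P Q} → P ≗ Q → turn v j P ≗ turn v j Q
  turn-cong v j eq u = cong₂ (λ s t → place ((top s + j) % N G v) _ (unplace (top s) _ t)) (eq v) (eq u)

  -- The order could only matter on a stack that both syllables write on. As `u` and `v` are near,
  -- such a stack belongs to a vertex far from both, and it receives the marker 0 twice.
  put-comm : ∀ {u v} → position u v ≡ near → ∀ e f Q → put u e (put v f Q) ≗ put v f (put u e Q)
  put-comm near₁ zero    f       Q w = refl
  put-comm near₁ (suc e) zero    Q w = refl
  put-comm {u} {v} near₁ (suc e) (suc f) Q w with position u w in eq₁ | position v w in eq₂
  ... | near | _    = refl
  ... | same | near = refl
  ... | far  | near = refl
  ... | far  | far  = refl
  ... | same | same with refl ← same⇒≡ eq₁ | refl ← same⇒≡ eq₂ = contradiction refl (near⇒≢ near₁)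
  ... | same | far with refl ← same⇒≡ eq₁ with () ← trans (sym eq₂) (trans (position-sym v u) near₁)
  ... | far  | same with refl ← same⇒≡ eq₂ with () ← trans (sym eq₁) near₁

  put-at : ∀ v e Q → put v e Q v ≡ place e same (Q v)
  put-at v e Q = cong (λ q → place e q (Q v)) (position-refl v)

  put-near : ∀ {u v} e Q → position v u ≡ near → put v e Q u ≡ Q u
  put-near {u} e Q eq = trans (cong (λ q → place e q (Q u)) eq) (place-near e (Q u))

  top-put : ∀ v e {P Q} → top (Q v) ≡ 0 → P ≗ put v e Q → top (P v) ≡ e
  top-put v e {P} {Q} clear eq = trans (cong top (trans (eq v) (put-at v e Q))) (top-place-same e clear)

  -- As `Q` shows no exponent at `v`, the top of `P` at `v` is exactly `e`, also for `e = 0`, and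
  -- `unplace` takes off just what `put` laid down.
  turn-put : ∀ v j e {P Q} → top (Q v) ≡ 0 → P ≗ put v e Q → turn v j P ≗ put v ((e + j) % N G v) Q
  turn-put v j e {P} {Q} clear eq u rewrite top-put v e {P} {Q} clear eq =
    cong (place _ (position v u)) (trans (cong (unplace e _) (eq u)) (unplace-place e _ (Q u)))

  -- A spelling is carried along, so that each reachable piling comes with a word for its element.
  -- The top 0 asked for by `add` keeps two syllables of one vertex from being mergeable. Pilings
  -- are functions, hence compared pointwise.
  data Heap : Piling → Word G → Set where
    empty : ∀ {P} → P ≗ (λ _ → []) → Heap P []
    add   : ∀ {P Q u} v e → Heap Q u → top (Q v) ≡ 0 → suc e < N G v →
            P ≗ put v (suc e) Q → Heap P (u ++ pow v (suc e))

  Heap-resp : ∀ {P P' u} → P' ≗ P → Heap P u → Heap P' u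
  Heap-resp eq (empty eq')               = empty (λ u → trans (eq u) (eq' u))
  Heap-resp eq (add v e h clear lt eq') = add v e h clear lt (λ u → trans (eq u) (eq' u))

  Heap-put : ∀ {Q u} v e → Heap Q u → top (Q v) ≡ 0 → e < N G v → Heap (put v e Q) (u ++ pow v e)
  Heap-put v zero    h clear lt = subst (Heap _) (sym (++-identityʳ _)) h
  Heap-put v (suc e) h clear lt = add v e h clear lt (λ _ → refl)

  -- Exponent 0 is allowed: it stands for the case that no `v`-syllable can be brought to the end.
  record Split (P : Piling) (u : Word G) (v : Fin (k G)) : Set where
    field
      {rest}   : Piling
      {word}   : Word G
      exponent : ℕ
      heap     : Heap rest word
      clear    : top (rest v) ≡ 0
      bound    : exponent < N G v
      shape    : P ≗ put v exponent rest
      spells   : Same G u (word ++ pow v exponent)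

  -- The last syllable decides. At `v` it is the one sought; at a far vertex its marker covers the
  -- stack of `v`, so the exponent is 0; at a near vertex the search goes on below it, and what is
  -- found is commuted past it.
  split : ∀ {P u} → Heap P u → ∀ v → Split P u v
  split (empty eq) v = record
    { exponent = 0 ; heap = empty (λ _ → refl) ; clear = refl
    ; bound = ≤-trans (s≤s z≤n) (N≥2 G v) ; shape = eq ; spells = ≈-refl }
  split {P} h@(add {Q = Q} x e hQ clr lt eq) v with position x v in pos-eq
  ... | same with refl ← same⇒≡ pos-eq = record
    { exponent = suc e ; heap = hQ ; clear = clr ; bound = lt ; shape = eq ; spells = ≈-refl }
  ... | far = record
    { exponent = 0 ; heap = h
    ; clear = cong top (trans (eq v) (cong (λ q → place (suc e) q (Q v)) pos-eq))
    ; bound = ≤-trans (s≤s z≤n) (N≥2 G v) ; shape = λ _ → refl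
    ; spells = ≡⇒Same (sym (++-identityʳ _)) }
  ... | near = record
    { exponent = f
    ; heap     = add x e (S .Split.heap) clr' lt (λ _ → refl)
    ; clear    = trans (cong top (put-near (suc e) R pos-eq)) (S .Split.clear)
    ; bound    = S .Split.bound
    ; shape    = λ u → trans (eq u) (trans (put-cong x (suc e) (S .Split.shape) u)
                                           (put-comm pos-eq (suc e) f R u))
    ; spells   = ≈-trans (++-congʳ (pow x (suc e)) (S .Split.spells))
        (≈-trans (≡⇒Same (++-assoc w (pow v f) _))
        (≈-trans (++-congˡ w (pow-comm (trans (adj-sym G v x) (near⇒adj pos-eq)) f (suc e)))
                 (≡⇒Same (sym (++-assoc w (pow x (suc e)) _))))) }
    where
    S = split hQ v
    f = S .Split.exponent
    R = S .Split.rest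
    w = S .Split.word
    -- Taking off a syllable at the near vertex `v` leaves the stack of `x` untouched, so `x` is
    -- still clear in the smaller rest.
    clr' : top (R x) ≡ 0
    clr' = trans (cong top (sym (trans (S .Split.shape x)
                   (put-near f R (trans (position-sym v x) pos-eq))))) clr

  Reachable : Piling → Set
  Reachable P = ∃ (Heap P)

  turn-heap : ∀ {P u} v j → Heap P u → ∃[ w ] Heap (turn v j P) w × Same G (u ++ pow v j) w
  turn-heap v j h = _ , Heap-resp (turn-put v j exponent clear shape)
                              (Heap-put v ((exponent + j) % N G v) heap clear (m%n<n _ (N G v)))
    , ≈-trans (++-congʳ (pow v j) spells)
      (≈-trans (≡⇒Same (trans (++-assoc word (pow v exponent) _) (cong (word ++_) (sym (pow-+ v exponent j)))))
               (++-congˡ word (pow-% v (exponent + j))))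
    where open Split (split h v)

  turn-reachable : ∀ {P} v j → Reachable P → Reachable (turn v j P)
  turn-reachable v j (_ , h) = let _ , h' , _ = turn-heap v j h in _ , h'

  -- Over the rest left by one `split`, a turn only adds to an exponent modulo `N G v`.
  turn-turn : ∀ {P} v i j → Reachable P → turn v j (turn v i P) ≗ turn v (i + j) P
  turn-turn {P} v i j (_ , h) u = begin
    turn v j (turn v i P) u
      ≡⟨ turn-put v j _ clear (turn-put v i exponent clear shape) u ⟩
    put v (((exponent + i) % n + j) % n) rest u
      ≡⟨ cong (λ e → put v e rest u) (mod-+ (exponent + i)) ⟩
    put v ((exponent + i + j) % n) rest u
      ≡⟨ cong (λ e → put v (e % n) rest u) (+-assoc exponent i j) ⟩
    put v ((exponent + (i + j)) % n) rest u           ≡⟨ turn-put v (i + j) exponent clear shape u ⟨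
    turn v (i + j) P u                                ∎
    where
    open Split (split h v)
    open ≡-Reasoning
    n = N G v
    mod-+ : ∀ a → (a % n + j) % n ≡ (a + j) % n
    mod-+ a = begin
      (a % n + j) % n           ≡⟨ %-distribˡ-+ (a % n) j n ⟩
      (a % n % n + j % n) % n   ≡⟨ cong (λ b → (b + j % n) % n) (m%n%n≡m%n a n) ⟩
      (a % n + j % n) % n       ≡⟨ %-distribˡ-+ a j n ⟨
      (a + j) % n               ∎

  turn-multiple : ∀ {P} v q → Reachable P → turn v (q * N G v) P ≗ P
  turn-multiple {P} v q (_ , h) u = trans (turn-put v _ exponent clear shape u)
    (trans (cong (λ e → put v e rest u) (trans ([m+kn]%n≡m%n exponent q (N G v)) (m<n⇒m%n≡m bound)))
           (sym (shape u)))
    where open Split (split h v)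

  -- Splitting off `u` and then `v` puts both syllables over one rest. Near vertices do not touch
  -- each other's stacks, so either order of turns sees the same tops, and `put-comm` does the rest.
  turn-comm : ∀ {P u v} i j → position u v ≡ near → Reachable P →
              turn v j (turn u i P) ≗ turn u i (turn v j P)
  turn-comm {P} {u} {v} i j near₁ (_ , h) w = begin
    turn v j (turn u i P) w  ≡⟨ turn-put v j f clear-v (λ x → trans (turn-put u i e S.clear S.shape x)
                                  (trans (put-cong u e' R.shape x) (put-comm near₁ e' f R.rest x))) w ⟩
    put v f' (put u e' R.rest) w ≡⟨ put-comm near₁ e' f' R.rest w ⟨
    put u e' (put v f' R.rest) w ≡⟨ turn-put u i e clear-u (λ x → trans
                                      (turn-put v j f clear-v' (λ y → trans (S.shape y)
                                        (trans (put-cong u e R.shape y) (put-comm near₁ e f R.rest y))) x)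
                                      (sym (put-comm near₁ e f' R.rest x))) w ⟨
    turn u i (turn v j P) w  ∎
    where
    module S = Split (split h u)
    module R = Split (split S.heap v)
    open ≡-Reasoning
    e = S.exponent
    f = R.exponent
    e' = (e + i) % N G u
    f' = (f + j) % N G v
    near₂ = trans (position-sym v u) near₁
    clear-v : top (put u e' R.rest v) ≡ 0
    clear-v = trans (cong top (put-near e' R.rest near₁)) R.clear
    clear-v' : top (put u e R.rest v) ≡ 0
    clear-v' = trans (cong top (put-near e R.rest near₁)) R.clear
    rest-u : top (R.rest u) ≡ 0
    rest-u = trans (cong top (sym (trans (R.shape u) (put-near f R.rest near₂)))) S.clear
    clear-u : top (put v f' R.rest u) ≡ 0
    clear-u = trans (cong top (put-near f' R.rest near₂)) rest-u

  -- The action of words on pilings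

  vertex : Letter G → Fin (k G)
  vertex (pos v)   = v
  vertex (neg v _) = v

  exponentOf : Letter G → ℕ
  exponentOf (pos v)   = 1
  exponentOf (neg v _) = N G v ∸ 1

  act : Letter G → Piling → Piling
  act l = turn (vertex l) (exponentOf l)

  run : Piling → Word G → Piling
  run P []      = P
  run P (l ∷ w) = run (act l P) w

  run-++ : ∀ P u w → run P (u ++ w) ≡ run (run P u) w
  run-++ P []      w = refl
  run-++ P (l ∷ u) w = run-++ (act l P) u w

  run-cong : ∀ w {P Q} → P ≗ Q → run P w ≗ run Q w
  run-cong []      eq = eq
  run-cong (l ∷ w) eq = run-cong w (turn-cong (vertex l) (exponentOf l) eq)

  run-reachable : ∀ w {P} → Reachable P → Reachable (run P w)
  run-reachable []      r = r
  run-reachable (l ∷ w) r = run-reachable w (turn-reachable (vertex l) (exponentOf l) r)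

  run-pow : ∀ v n {P} → Reachable P → run P (pow v n) ≗ turn v n P
  -- Turning by 0 takes the top off and puts it back, which is not the identity by computation; it
  -- is the multiple 0 of the order.
  run-pow v zero    r u = sym (turn-multiple v 0 r u)
  run-pow v (suc n) r u = trans (run-pow v n (turn-reachable v 1 r) u) (turn-turn v 1 n r u)

  pred-+1 : ∀ v → N G v ∸ 1 + 1 ≡ 1 * N G v
  pred-+1 v = trans (m∸n+n≡m (≤-trans (s≤s z≤n) (N≥2 G v))) (sym (*-identityˡ _))

  run-relator : ∀ {l r} → Relator G l r → ∀ {P} → Reachable P → run P l ≗ run P r
  run-relator (power v)  {P} r u = trans (run-pow v (N G v) r u)
    (trans (cong (λ n → turn v n P u) (sym (*-identityˡ (N G v)))) (turn-multiple v 1 r u))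
  run-relator (invR v p) {P} r u = trans (turn-turn v 1 (N G v ∸ 1) r u)
    (trans (cong (λ n → turn v n P u) (trans (+-comm 1 _) (pred-+1 v))) (turn-multiple v 1 r u))
  run-relator (invL v p) {P} r u = trans (turn-turn v (N G v ∸ 1) 1 r u)
    (trans (cong (λ n → turn v n P u) (pred-+1 v)) (turn-multiple v 1 r u))
  run-relator (comm x v a) r u = turn-comm 1 1 (adj⇒near (T⇒≡ a)) r u
    where
    T⇒≡ : ∀ {b} → T b → b ≡ true
    T⇒≡ {true} _ = refl

  run-Same : ∀ {l r} → Same G l r → ∀ {P} → Reachable P → run P l ≗ run P r
  run-Same (≈-step xs {l} {r} ys rel) {P} re u
    rewrite run-++ P xs (l ++ ys) | run-++ P xs (r ++ ys)
          | run-++ (run P xs) l ys | run-++ (run P xs) r ys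
    = run-cong ys (run-relator rel (run-reachable xs re)) u
  run-Same ≈-refl        re u = refl
  run-Same (≈-sym p)     re u = sym (run-Same p re u)
  run-Same (≈-trans p q) re u = trans (run-Same p re u) (run-Same q re u)

  -- Word length

  weight : Fin (k G) → List ℕ → ℕ
  weight v []      = 0
  weight v (e ∷ s) = cost (N G v) e + weight v s

  norm : Piling → ℕ
  norm P = sum (λ v → weight v (P v))

  norm-cong : ∀ {P Q} → P ≗ Q → norm P ≡ norm Q
  norm-cong eq = sum-cong-≗ (λ v → cong (weight v) (eq v))

  -- The marker 0 costs nothing, so a syllable is charged on the stack of its own vertex only.
  charge : Position → ℕ → Fin (k G) → ℕ
  charge same e v = cost (N G v) e
  charge near _ _ = 0
  charge far  _ _ = 0

  weight-place : ∀ v q e {s} → weight v (place e q s) ≡ charge q e v + weight v s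
  weight-place v same zero    = refl
  weight-place v near zero    = refl
  weight-place v far  zero    = refl
  weight-place v same (suc e) = refl
  weight-place v near (suc e) = refl
  weight-place v far  (suc e) = refl

  norm-put : ∀ v e Q → norm (put v e Q) ≡ cost (N G v) e + norm Q
  norm-put v e Q = begin
    norm (put v e Q)
      ≡⟨ sum-cong-≗ (λ u → weight-place u (position v u) e) ⟩
    sum (λ u → charge (position v u) e u + weight u (Q u))
      ≡⟨ ∑-distrib-+ (λ u → charge (position v u) e u) _ ⟩
    sum (λ u → charge (position v u) e u) + norm Q
      ≡⟨ cong (_+ norm Q) (sum-single v elsewhere) ⟩
    charge (position v v) e v + norm Q
      ≡⟨ cong (λ q → charge q e v + norm Q) (position-refl v) ⟩
    cost (N G v) e + norm Q                                 ∎
    where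
    open ≡-Reasoning
    elsewhere : ∀ u → u ≢ v → charge (position v u) e u ≡ 0
    elsewhere u u≢v with position v u in eq
    ... | same = contradiction (sym (same⇒≡ eq)) u≢v
    ... | near = refl
    ... | far  = refl

  topCost : Fin (k G) → Piling → ℕ
  topCost v P = cost (N G v) (top (P v))

  top<N : ∀ {P} v → Reachable P → top (P v) < N G v
  top<N {P} v (_ , h) = subst (_< N G v) (sym (top-put v exponent {P} {rest} clear shape)) bound
    where open Split (split h v)

  -- Over the rest left by `split`, the two norms differ only by the costs of the old and the new
  -- exponent. The additive form avoids truncated subtraction.
  norm-turn : ∀ {P} v j → Reachable P →
              topCost v P + norm (turn v j P) ≡ cost (N G v) (residue v j P) + norm P
  norm-turn {P} v j (_ , h) = begin
    topCost v P + norm (turn v j P)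
      ≡⟨ cong₂ _+_ (cong (cost n) top≡) (norm-cong (turn-put v j exponent clear shape)) ⟩
    cost n exponent + norm (put v ((exponent + j) % n) rest)
      ≡⟨ cong (cost n exponent +_) (norm-put v _ rest) ⟩
    cost n exponent + (cost n ((exponent + j) % n) + norm rest)
      ≡⟨ x∙yz≈y∙xz (cost n exponent) (cost n ((exponent + j) % n)) (norm rest) ⟩
    cost n ((exponent + j) % n) + (cost n exponent + norm rest)
      ≡⟨ cong (cost n ((exponent + j) % n) +_) (norm-put v exponent rest) ⟨
    cost n ((exponent + j) % n) + norm (put v exponent rest)
      ≡⟨ cong₂ (λ e m → cost n ((e + j) % n) + m) top≡ (norm-cong shape) ⟨
    cost n (residue v j P) + norm P ∎
    where
    open Split (split h v)
    open ≡-Reasoning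
    n = N G v
    top≡ : top (P v) ≡ exponent
    top≡ = top-put v exponent {P} {rest} clear shape

  -- A local test, reading a single stack, for the norm going up by 1; `norm-raise` and `raise-norm`
  -- give the equivalence.
  Raises : Piling → Letter G → Set
  Raises P l = cost (N G (vertex l)) (residue (vertex l) (exponentOf l) P) ≡ suc (topCost (vertex l) P)

  cost-act-≤ : ∀ {P} l → Reachable P →
    cost (N G (vertex l)) (residue (vertex l) (exponentOf l) P) ≤ suc (topCost (vertex l) P)
  cost-act-≤ {P} (pos v)   r = cost-step-up (N G v) (top (P v)) (top<N v r)
  cost-act-≤ {P} (neg v _) r = cost-step-down (N G v) (top (P v)) (top<N v r)

  act-reachable : ∀ {P} l → Reachable P → Reachable (act l P)
  act-reachable l = turn-reachable (vertex l) (exponentOf l)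

  norm-act-≤ : ∀ {P} l → Reachable P → norm (act l P) ≤ suc (norm P)
  norm-act-≤ {P} l r = +-cancelˡ-≤ c _ _ $ begin
    c + norm (act l P)   ≡⟨ norm-turn (vertex l) (exponentOf l) r ⟩
    _ + norm P           ≤⟨ +-monoˡ-≤ (norm P) (cost-act-≤ l r) ⟩
    suc c + norm P       ≡⟨ +-suc c (norm P) ⟨
    c + suc (norm P)     ∎
    where
    open ≤-Reasoning
    c = topCost (vertex l) P

  norm-raise : ∀ {P} l → Reachable P → Raises P l → norm (act l P) ≡ suc (norm P)
  norm-raise {P} l r raises = +-cancelˡ-≡ c _ _
    (trans (norm-turn (vertex l) (exponentOf l) r)
      (trans (cong (_+ norm P) raises) (sym (+-suc c (norm P)))))
    where c = topCost (vertex l) P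

  raise-norm : ∀ {P} l → Reachable P → norm (act l P) ≡ suc (norm P) → Raises P l
  raise-norm {P} l r eq = +-cancelʳ-≡ (norm P) _ _
    (trans (sym (norm-turn (vertex l) (exponentOf l) r))
      (trans (cong (c +_) eq) (+-suc c (norm P))))
    where c = topCost (vertex l) P

  Accepts : Piling → Word G → Set
  Accepts P []      = ⊤
  Accepts P (l ∷ w) = Raises P l × Accepts (act l P) w

  norm-run-≤ : ∀ w {P} → Reachable P → norm (run P w) ≤ length w + norm P
  norm-run-≤ []      r = ≤-refl
  norm-run-≤ (l ∷ w) r = ≤-trans (norm-run-≤ w (act-reachable l r))
    (≤-trans (+-monoʳ-≤ (length w) (norm-act-≤ l r)) (≤-reflexive (+-suc (length w) _)))

  accepts⇒norm : ∀ w {P} → Reachable P → Accepts P w → norm (run P w) ≡ length w + norm P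
  accepts⇒norm []      r _          = refl
  accepts⇒norm (l ∷ w) r (raises , acc) = trans (accepts⇒norm w (act-reachable l r) acc)
    (trans (cong (length w +_) (norm-raise l r raises)) (+-suc (length w) _))

  -- No letter raises the norm by more than 1, so a letter that falls short cannot be made up for by
  -- the rest of the word.
  norm⇒accepts : ∀ w {P} → Reachable P → length w + norm P ≤ norm (run P w) → Accepts P w
  norm⇒accepts []      r _  = _
  norm⇒accepts (l ∷ w) {P} r le = raise-norm l r norm≡ , norm⇒accepts w (act-reachable l r)
      (≤-trans (≤-reflexive (trans (cong (length w +_) norm≡) (+-suc (length w) _))) le)
    where
    norm≡ : norm (act l P) ≡ suc (norm P)
    norm≡ = ≤-antisym (norm-act-≤ l r) (+-cancelˡ-≤ (length w) _ _
      (≤-trans (≤-reflexive (+-suc (length w) _)) (≤-trans le (norm-run-≤ w (act-reachable l r)))))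

  -- Words that attain the norm

  pow-neg-cancel : ∀ v p n → Same G (pow v n ++ replicate n (neg v p)) []
  pow-neg-cancel v p zero    = ≈-refl
  pow-neg-cancel v p (suc n) = ≈-trans
    (≡⇒Same (cong (pos v ∷_) (trans (cong (pow v n ++_) (snoc n)) (sym (++-assoc (pow v n) _ _)))))
    (≈-trans (++-congˡ [ pos v ] (++-congʳ [ neg v p ] (pow-neg-cancel v p n))) (relator (invR v p)))
    where
    snoc : ∀ n → replicate (suc n) (neg v p) ≡ replicate n (neg v p) ++ [ neg v p ]
    snoc zero    = refl
    snoc (suc n) = cong (neg v p ∷_) (snoc n)

  -- Up to half of the order positive letters serve; beyond it `N - e` inverse letters do, since
  -- `v^e` followed by `v^(N - e)` is trivial. At order 2 there is no inverse letter, but the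
  -- exponents 0 and 1 do not exceed half.
  syllable : ∀ v e → e < N G v → ∃[ s ] Same G (pow v e) s × length s ≡ cost (N G v) e
  syllable v e e<N with e ≤? N G v ∸ e | T? (not (N G v ≡ᵇ 2))
  ... | yes short | _     = pow v e , ≈-refl , trans (length-replicate e) (sym (m≤n⇒m⊓n≡m short))
  ... | no long   | yes p = replicate c (neg v p) ,
        ≈-trans (≡⇒Same (sym (++-identityʳ _)))
        (≈-trans (++-congˡ (pow v e) (≈-sym (pow-neg-cancel v p c)))
        (≈-trans (≡⇒Same (trans (sym (++-assoc (pow v e) (pow v c) _))
                           (cong (_++ replicate c (neg v p)) (trans (sym (pow-+ v e c))
                              (cong (pow v) (m+[n∸m]≡n (<⇒≤ e<N)))))))
                 (++-congʳ _ (relator (power v)))))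
      , trans (length-replicate c) (sym (m≥n⇒m⊓n≡n (<⇒≤ (≰⇒> long))))
      where c = N G v ∸ e
  ... | no long   | no ¬p = contradiction (order-two (N G v) e e<N ¬p) long
    where
    -- The negated premise forces `n = 2`: for every other order it denies an inhabited type.
    order-two : ∀ n e → e < n → ¬ T (not (n ≡ᵇ 2)) → e ≤ n ∸ e
    order-two 0                   e             e<n              ¬p = contradiction _ ¬p
    order-two 1                   e             e<n              ¬p = contradiction _ ¬p
    order-two 2                   0             e<n              ¬p = z≤n
    order-two 2                   1             e<n              ¬p = s≤s z≤n
    order-two 2                   (suc (suc e)) (s≤s (s≤s ()))   ¬p
    order-two (suc (suc (suc n))) e             e<n              ¬p = contradiction _ ¬p

  -- Each syllable is spelled with as many letters as it contributes to the norm, by `syllable`.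
  heap-word : ∀ {P u} → Heap P u → ∃[ s ] Same G u s × length s ≡ norm P
  heap-word (empty eq) = [] , ≈-refl , sym (trans (norm-cong eq) (sum-replicate-zero (k G)))
  heap-word (add {Q = Q} {u} v e h clear lt eq) =
    let s , u~s , len  = heap-word h
        t , p~t , len' = syllable v (suc e) lt
    in s ++ t , ≈-trans (++-congʳ _ u~s) (++-congˡ s p~t) ,
       trans (length-++ s) (trans (cong₂ _+_ len len') (trans (+-comm (norm Q) _)
         (sym (trans (norm-cong eq) (norm-put v (suc e) Q)))))

  letter-pow : ∀ l → Same G [ l ] (pow (vertex l) (exponentOf l))
  letter-pow (pos v)   = ≈-refl
  -- The inverse letter is followed by the trivial word `v^N`, whose first letter then cancels
  -- against it.
  letter-pow (neg v p) = ≈-trans (++-congˡ [ neg v p ] (≈-sym (relator (power v))))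
    (≈-trans (≡⇒Same (cong (λ n → neg v p ∷ pow v n) (sym (trans (+-comm 1 _) (trans (pred-+1 v) (*-identityˡ _))))))
             (++-congʳ (pow v (N G v ∸ 1)) (relator (invL v p))))

  run-heap : ∀ w {P u} → Heap P u → ∃[ t ] Heap (run P w) t × Same G (u ++ w) t
  run-heap []      {u = u} h = u , h , ≡⇒Same (++-identityʳ u)
  run-heap (l ∷ w) {u = u} h =
    let s , h' , us = turn-heap (vertex l) (exponentOf l) h
        t , h'' , st = run-heap w h'
    in t , h'' , ≈-trans (≡⇒Same (sym (++-assoc u [ l ] w)))
         (≈-trans (++-congʳ w (≈-trans (++-congˡ u (letter-pow l)) us)) st)

  ground : Piling
  ground _ = []

  ground-heap : Heap ground []
  ground-heap = empty (λ _ → refl)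

  norm-ground : norm ground ≡ 0
  norm-ground = sum-replicate-zero (k G)

  -- Every word for the same element runs to the same piling, whose norm equals the length of `w`
  -- and is at most that of the other word.
  accepts⇒geodesic : ∀ w → Accepts ground w → IsGeodesic G w
  accepts⇒geodesic w acc u u~w = begin
    length w                ≤⟨ m≤m+n _ _ ⟩
    length w + norm ground  ≡⟨ accepts⇒norm w reach acc ⟨
    norm (run ground w)     ≡⟨ norm-cong (run-Same u~w reach) ⟨
    norm (run ground u)     ≤⟨ norm-run-≤ u reach ⟩
    length u + norm ground  ≡⟨ cong (length u +_) norm-ground ⟩
    length u + 0            ≡⟨ +-identityʳ _ ⟩
    length u                ∎
    where
    open ≤-Reasoning
    reach = _ , ground-heap

  -- The geodesic is compared with the word of length `norm` that `heap-word` gives for its final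
  -- piling.
  geodesic⇒accepts : ∀ w → IsGeodesic G w → Accepts ground w
  geodesic⇒accepts w geo =
    let t , h , w~t = run-heap w ground-heap
        s , t~s , len = heap-word h
    in norm⇒accepts w (_ , ground-heap) $ begin
      length w + norm ground ≡⟨ cong (length w +_) norm-ground ⟩
      length w + 0           ≡⟨ +-identityʳ _ ⟩
      length w               ≤⟨ geo s (≈-sym (≈-trans w~t t~s)) ⟩
      length s               ≡⟨ len ⟩
      norm (run ground w)    ∎
    where open ≤-Reasoning

  -- Enumeration of geodesics

  raises? : ∀ P l → Dec (Raises P l)
  raises? P l = _ ℕ.≟ _

  -- The decision is an argument so that later lemmas can match on it, separately for the two
  -- graphs.
  inversesIf : ∀ v → Dec (T (not (N G v ≡ᵇ 2))) → List (Letter G)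
  inversesIf v (yes p) = [ neg v p ]
  inversesIf v (no _)  = []

  inverses : Fin (k G) → List (Letter G)
  inverses v = inversesIf v (T? (not (N G v ≡ᵇ 2)))

  lettersAt : Fin (k G) → List (Letter G)
  lettersAt v = pos v ∷ inverses v

  mutual
    -- The first letter is chosen in two stages, vertex and then sign, because the two graphs are
    -- compared through sums over vertices.
    accepted : ℕ → Piling → List (Word G)
    accepted zero    P = [ [] ]
    accepted (suc n) P = concatMap (acceptedAt n P) (List.allFin (k G))

    acceptedAt : ℕ → Piling → Fin (k G) → List (Word G)
    acceptedAt n P v = concatMap (acceptedVia n P) (lettersAt v)

    acceptedVia : ℕ → Piling → Letter G → List (Word G)
    acceptedVia n P l = keepIf (raises? P l) (map (l ∷_) (accepted n (act l P)))

  ∈-inverses : ∀ v p → neg v p ∈ inverses v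
  ∈-inverses v p with T? (not (N G v ≡ᵇ 2))
  ... | yes q = here (cong (neg v) (T-irrelevant p q))
  ... | no ¬p = contradiction p ¬p

  vertex-inversesIf : ∀ v d {l} → l ∈ inversesIf v d → vertex l ≡ v
  vertex-inversesIf v (yes p) (here refl) = refl

  pos∉inversesIf : ∀ v d → pos v ∉ inversesIf v d
  pos∉inversesIf v (yes _) (here ())

  inversesIf-unique : ∀ v d → Unique (inversesIf v d)
  inversesIf-unique v (yes _) = [] ∷ []
  inversesIf-unique v (no _)  = []

  ∈-lettersAt : ∀ l → l ∈ lettersAt (vertex l)
  ∈-lettersAt (pos v)   = here refl
  ∈-lettersAt (neg v p) = there (∈-inverses v p)

  vertex-lettersAt : ∀ v {l} → l ∈ lettersAt v → vertex l ≡ v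
  vertex-lettersAt v (here refl) = refl
  vertex-lettersAt v (there l∈)  = vertex-inversesIf v _ l∈

  lettersAt-unique : ∀ v → Unique (lettersAt v)
  lettersAt-unique v =
    All.tabulate (λ l∈ eq → pos∉inversesIf v _ (subst (_∈ inverses v) (sym eq) l∈)) ∷ inversesIf-unique v _

  ∈-acceptedVia : ∀ n P l {w} → w ∈ acceptedVia n P l →
    Raises P l × ∃[ u ] u ∈ accepted n (act l P) × w ≡ l ∷ u
  ∈-acceptedVia n P l w∈ =
    let raises , w∈map = ∈-keepIf⁻ (raises? P l) w∈ in raises , ∈-map⁻ (l ∷_) w∈map

  ∈-accepted : ∀ n P {w} → w ∈ accepted (suc n) P → ∃[ l ] w ∈ acceptedVia n P l
  ∈-accepted n P w∈ =
    let v , _ , w∈v = find (∈-concatMap⁻ (acceptedAt n P) {xs = List.allFin (k G)} w∈)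
        l , _ , w∈l = find (∈-concatMap⁻ (acceptedVia n P) {xs = lettersAt v} w∈v)
    in l , w∈l

  accepted-sound : ∀ n P {w} → w ∈ accepted n P → length w ≡ n × Accepts P w
  accepted-sound zero    P (here refl) = refl , _
  accepted-sound (suc n) P w∈
    with l , w∈l ← ∈-accepted n P w∈
    with raises , u , u∈ , refl ← ∈-acceptedVia n P l w∈l
    = let len , acc = accepted-sound n (act l P) u∈ in cong suc len , raises , acc

  accepted-complete : ∀ w P → Accepts P w → w ∈ accepted (length w) P
  accepted-complete []      P _              = here refl
  accepted-complete (l ∷ w) P (raises , acc) =
    ∈-concatMap⁺ (acceptedAt (length w) P) (lose (∈-allFin (vertex l))
      (∈-concatMap⁺ (acceptedVia (length w) P) (lose (∈-lettersAt l)
        (∈-keepIf⁺ (raises? P l) raises (∈-map⁺ (l ∷_) (accepted-complete w (act l P) acc))))))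

  acceptedVia-head : ∀ n P {l l' w} → w ∈ acceptedVia n P l → w ∈ acceptedVia n P l' → l ≡ l'
  acceptedVia-head n P {l} {l'} w∈ w∈' =
    let _ , _ , _ , eq  = ∈-acceptedVia n P l w∈
        _ , _ , _ , eq' = ∈-acceptedVia n P l' w∈'
    in ∷-injectiveˡ (trans (sym eq) eq')

  acceptedAt-vertex : ∀ n P {v v' w} → w ∈ acceptedAt n P v → w ∈ acceptedAt n P v' → v ≡ v'
  acceptedAt-vertex n P {v} {v'} w∈ w∈' =
    let _ , l∈  , w∈l  = find (∈-concatMap⁻ (acceptedVia n P) {xs = lettersAt v} w∈)
        _ , l∈' , w∈l' = find (∈-concatMap⁻ (acceptedVia n P) {xs = lettersAt v'} w∈')
    in trans (sym (vertex-lettersAt v l∈))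
         (trans (cong vertex (acceptedVia-head n P w∈l w∈l')) (vertex-lettersAt v' l∈'))

  accepted-unique : ∀ n P → Unique (accepted n P)
  accepted-unique zero    P = [] ∷ []
  accepted-unique (suc n) P =
    concatMap-unique (λ v → concatMap-unique via-unique (acceptedVia-head n P) (lettersAt-unique v))
      (acceptedAt-vertex n P) (Unique.allFin⁺ (k G))
    where
    via-unique : ∀ l → Unique (acceptedVia n P l)
    via-unique l = keepIf-unique (raises? P l) (Unique.map⁺ ∷-injectiveʳ (accepted-unique n (act l P)))

  geodesic-count : ∀ n L → EnumeratesGeodesics G n L → length L ≡ length (accepted n ground)
  geodesic-count n L (L! , L-spec) = ↭-length (∼bag⇒↭ (unique∧set⇒bag L! (accepted-unique n ground)
    (λ {w} → mk⇔ (to w) (from w))))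
    where
    to : ∀ w → w ∈ L → w ∈ accepted n ground
    to w w∈ with refl , geo ← proj₁ (L-spec w) w∈ = accepted-complete w ground (geodesic⇒accepts w geo)
    from : ∀ w → w ∈ accepted n ground → w ∈ L
    from w w∈ = let len , acc = accepted-sound n ground w∈
                in proj₂ (L-spec w) (len , accepts⇒geodesic w acc)

  -- Cliques and links

  Near : Fin (k G) → Fin (k G) → Set
  Near u v = position u v ≡ near

  Clique : List (Fin (k G)) → Set
  Clique = AllPairs Near

  member : List (Fin (k G)) → Fin (k G) → Bool
  member A v = any (λ a → does (v ≟ a)) A

  vertexSet : List (Fin (k G)) → VSet G
  vertexSet A = tabulate (member A)

  allNear : List (Fin (k G)) → Fin (k G) → Bool
  allNear A v = all (λ a → does (position v a ≟ᴾ near)) A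

  countFin≡sum : ∀ n (p : Fin n → Bool) → countFin n p ≡ sum (indicator ∘ p)
  countFin≡sum zero    p = refl
  countFin≡sum (suc n) p = cong (indicator (p zero) +_) (countFin≡sum n (p ∘ suc))

  member⇒∈ : ∀ A v → T (member A v) → v ∈ A
  member⇒∈ (a ∷ A) v m with v ≟ a
  ... | yes v≡a = here v≡a
  ... | no _    = there (member⇒∈ A v m)

  clique-isClique : ∀ {A} → Clique A → IsClique G (vertexSet A)
  clique-isClique {A} clique u v u∈ v∈ u≢v = subst T (sym (near⇒adj (pick clique (mem u u∈) (mem v v∈)))) _
    where
    mem : ∀ w → T (lookup (vertexSet A) w) → w ∈ A
    mem w t = member⇒∈ A w (subst T (lookup∘tabulate (member A) w) t)
    pick : ∀ {B} → Clique B → u ∈ B → v ∈ B → Near u v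
    pick (b ∷ c) (here refl) (here refl) = contradiction refl u≢v
    pick (b ∷ c) (here refl) (there v∈)  = All.lookup b v∈
    pick (b ∷ c) (there u∈)  (here refl) = trans (position-sym u v) (All.lookup b u∈)
    pick (b ∷ c) (there u∈)  (there v∈)  = pick c u∈ v∈

  near-member : ∀ {v A} → All (Near v) A → member A v ≡ false
  near-member []           = refl
  near-member {v} (_∷_ {x = a} n ns) rewrite dec-false (v ≟ a) (near⇒≢ n) = near-member ns

  near-allNear : ∀ {v A} → All (Near v) A → allNear A v ≡ true
  near-allNear []       = refl
  near-allNear (n ∷ ns) rewrite n = near-allNear ns

  mult-vertexSet : ∀ A m → mult G (vertexSet A) m ≡ sum (λ v → indicator (member A v ∧ (N G v ≡ᵇ m)))
  mult-vertexSet A m = trans (countFin≡sum (k G) _)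
    (sum-cong-≗ (λ v → cong (λ b → indicator (b ∧ (N G v ≡ᵇ m))) (lookup∘tabulate (member A) v)))

  -- `a` is near to all of `A`, hence not among them, so no vertex is counted twice.
  mult-∷ : ∀ {a A} m → All (Near a) A →
    mult G (vertexSet (a ∷ A)) m ≡ indicator (N G a ≡ᵇ m) + mult G (vertexSet A) m
  mult-∷ {a} {A} m nears = begin
    mult G (vertexSet (a ∷ A)) m                           ≡⟨ mult-vertexSet (a ∷ A) m ⟩
    sum (λ v → indicator (member (a ∷ A) v ∧ (N G v ≡ᵇ m))) ≡⟨ sum-cong-≗ disjoint ⟩
    sum (λ v → at-a v + in-A v)                            ≡⟨ ∑-distrib-+ at-a in-A ⟩
    sum at-a + sum in-A
      ≡⟨ cong₂ _+_ (trans (sum-single a off-a) on-a) (sym (mult-vertexSet A m)) ⟩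
    indicator (N G a ≡ᵇ m) + mult G (vertexSet A) m        ∎
    where
    open ≡-Reasoning
    at-a in-A : Fin (k G) → ℕ
    at-a v = indicator (does (v ≟ a) ∧ (N G v ≡ᵇ m))
    in-A v = indicator (member A v ∧ (N G v ≡ᵇ m))
    disjoint : ∀ v → indicator (member (a ∷ A) v ∧ (N G v ≡ᵇ m)) ≡ at-a v + in-A v
    disjoint v with v ≟ a
    ... | no _     = refl
    ... | yes refl rewrite near-member nears = sym (+-identityʳ _)
    off-a : ∀ v → v ≢ a → at-a v ≡ 0
    off-a v v≢a with v ≟ a
    ... | yes v≡a = contradiction v≡a v≢a
    ... | no _    = refl
    on-a : at-a a ≡ indicator (N G a ≡ᵇ m)
    on-a with a ≟ a
    ... | yes _  = refl
    ... | no a≢a = contradiction refl a≢a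

  linked : List (Fin (k G)) → Fin (k G) → Bool
  linked A v = not (member A v) ∧ Defs.allFin (k G) (λ u → not (member A u) ∨ adj G u v)

  allFin-cong : ∀ n {p q : Fin n → Bool} → p ≗ q → Defs.allFin n p ≡ Defs.allFin n q
  allFin-cong zero    eq = refl
  allFin-cong (suc n) eq = cong₂ _∧_ (eq zero) (allFin-cong n (eq ∘ suc))

  allFin-true : ∀ n → Defs.allFin n (λ _ → true) ≡ true
  allFin-true zero    = refl
  allFin-true (suc n) = allFin-true n

  allFin-∧ : ∀ n (p q : Fin n → Bool) → Defs.allFin n (λ i → p i ∧ q i) ≡ Defs.allFin n p ∧ Defs.allFin n q
  allFin-∧ zero    p q = refl
  allFin-∧ (suc n) p q = trans (cong ((p zero ∧ q zero) ∧_) (allFin-∧ n (p ∘ suc) (q ∘ suc)))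
    (∧-interchange (p zero) (q zero) _ _)

  allFin-single : ∀ n (p : Fin n → Bool) a → Defs.allFin n (λ u → not (does (u ≟ a)) ∨ p u) ≡ p a
  allFin-single (suc n) p zero    = trans (cong (p zero ∧_) (allFin-true n)) (∧-identityʳ _)
  allFin-single (suc n) p (suc a) = allFin-single n (p ∘ suc) a

  -- De Morgan splits the conditions on `a` off both factors of the link; for this one vertex, being
  -- distinct and being adjacent together amount to `near`.
  linked-∷ : ∀ a A v → linked (a ∷ A) v ≡ does (position v a ≟ᴾ near) ∧ linked A v
  linked-∷ a A v = begin
    not (does (v ≟ a) ∨ member A v) ∧ Defs.allFin (k G) (λ u → not (does (u ≟ a) ∨ member A u) ∨ adj G u v)
      ≡⟨ cong₂ _∧_ (deMorgan₂ (does (v ≟ a)) _) (trans (allFin-cong (k G) (λ u →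
           trans (cong (_∨ adj G u v) (deMorgan₂ (does (u ≟ a)) _)) (∨-distribʳ-∧ (adj G u v) (not (does (u ≟ a))) _)))
           (allFin-∧ (k G) (λ u → not (does (u ≟ a)) ∨ adj G u v) _)) ⟩
    (not (does (v ≟ a)) ∧ not (member A v)) ∧ (Defs.allFin (k G) (λ u → not (does (u ≟ a)) ∨ adj G u v) ∧ rest)
      ≡⟨ ∧-interchange (not (does (v ≟ a))) _ _ _ ⟩
    (not (does (v ≟ a)) ∧ Defs.allFin (k G) (λ u → not (does (u ≟ a)) ∨ adj G u v)) ∧ linked A v
      ≡⟨ cong (_∧ linked A v) (trans (cong (not (does (v ≟ a)) ∧_)
           (trans (allFin-single (k G) (λ u → adj G u v) a) (adj-sym G a v))) adjacent) ⟩
    does (position v a ≟ᴾ near) ∧ linked A v ∎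
    where
    open ≡-Reasoning
    rest = Defs.allFin (k G) (λ u → not (member A u) ∨ adj G u v)
    adjacent : not (does (v ≟ a)) ∧ adj G v a ≡ does (position v a ≟ᴾ near)
    adjacent with v ≟ a | adj G v a
    ... | yes _ | _     = refl
    ... | no _  | true  = refl
    ... | no _  | false = refl

  linked≡allNear : ∀ A v → linked A v ≡ allNear A v
  linked≡allNear []      v = allFin-true (k G)
  linked≡allNear (a ∷ A) v = trans (linked-∷ a A v) (cong (_ ∧_) (linked≡allNear A v))

  mult-Lk : ∀ A m → mult G (Lk G (vertexSet A)) m ≡ sum (λ v → indicator (allNear A v ∧ (N G v ≡ᵇ m)))
  mult-Lk A m = trans (countFin≡sum (k G) _) (sum-cong-≗ (λ v →
    cong (λ b → indicator (b ∧ (N G v ≡ᵇ m)))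
      (trans (lookup∘tabulate _ v) (trans (cong₂ _∧_ (cong not (lookup∘tabulate (member A) v))
        (allFin-cong (k G) (λ u → cong (λ b → not b ∨ adj G u v) (lookup∘tabulate (member A) u))))
        (linked≡allNear A v)))))

  -- Counting vertices by number and trace

  trace : List (Fin (k G)) → Fin (k G) → List Position
  trace B v = map (position v) B

  -- `A` holds the vertices already forced to be near, `B` those whose positions are prescribed one
  -- by one by `p`: the bookkeeping of an inclusion-exclusion over the subsets of a clique. With `B`
  -- and `p` empty it counts a link.
  hits : (A B : List (Fin (k G))) → ℕ → List Position → Fin (k G) → ℕ
  hits A B m p v = indicator (allNear A v ∧ ((N G v ≡ᵇ m) ∧ does (≡-dec _≟ᴾ_ (trace B v) p)))

  hits-[] : ∀ A m → sum (hits A [] m []) ≡ mult G (Lk G (vertexSet A)) m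
  hits-[] A m = trans (sum-cong-≗ (λ v → cong (λ b → indicator (allNear A v ∧ b)) (∧-identityʳ (N G v ≡ᵇ m))))
    (sym (mult-Lk A m))

  hits-mismatch : ∀ A B m p → (∀ v → trace B v ≢ p) → sum (hits A B m p) ≡ 0
  hits-mismatch A B m p differ = sum-vanishing vanish
    where
    vanish : ∀ v → hits A B m p v ≡ 0
    vanish v rewrite dec-false (≡-dec _≟ᴾ_ (trace B v) p) (differ v) | ∧-zeroʳ (N G v ≡ᵇ m)
                   | ∧-zeroʳ (allNear A v) = refl

  hits-near : ∀ A b B m p → sum (hits A (b ∷ B) m (near ∷ p)) ≡ sum (hits (b ∷ A) B m p)
  hits-near A b B m p = sum-cong-≗ (λ v → indicator-shuffle (allNear A v) (N G v ≡ᵇ m)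
    (does (position v b ≟ᴾ near)) (does (≡-dec _≟ᴾ_ (trace B v) p)))

  -- Only `b` is in position `same` to `b`, and it is near to everything else listed, so its trace
  -- on `B` is constant and the sum is 0 or 1.
  hits-same : ∀ A b B m p → All (Near b) A → All (Near b) B → sum (hits A (b ∷ B) m (same ∷ p)) ≡
    indicator ((N G b ≡ᵇ m) ∧ does (≡-dec _≟ᴾ_ (replicate (length B) near) p))
  hits-same A b B m p nearA nearB = trans (sum-single b elsewhere) at-b
    where
    elsewhere : ∀ v → v ≢ b → hits A (b ∷ B) m (same ∷ p) v ≡ 0
    elsewhere v v≢b rewrite dec-false (position v b ≟ᴾ same) (v≢b ∘ same⇒≡) | ∧-zeroʳ (N G v ≡ᵇ m)
                          | ∧-zeroʳ (allNear A v) = refl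
    all-near : ∀ {C} → All (Near b) C → trace C b ≡ replicate (length C) near
    all-near []       = refl
    all-near (n ∷ ns) = cong₂ _∷_ n (all-near ns)
    at-b : hits A (b ∷ B) m (same ∷ p) b ≡
           indicator ((N G b ≡ᵇ m) ∧ does (≡-dec _≟ᴾ_ (replicate (length B) near) p))
    at-b rewrite near-allNear nearA | position-refl b | all-near nearB = refl

  hits-split : ∀ A b B m p → sum (hits A B m p) ≡ sum (hits A (b ∷ B) m (same ∷ p)) +
    (sum (hits A (b ∷ B) m (near ∷ p)) + sum (hits A (b ∷ B) m (far ∷ p)))
  hits-split A b B m p = trans
    (sum-cong-≗ (λ v → indicator-position (allNear A v) (N G v ≡ᵇ m)
      (does (≡-dec _≟ᴾ_ (trace B v) p)) (position v b)))
    (trans (∑-distrib-+ (h same) (λ v → h near v + h far v))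
           (cong (sum (h same) +_) (∑-distrib-+ (h near) (h far))))
    where
    h : Position → Fin (k G) → ℕ
    h q = hits A (b ∷ B) m (q ∷ p)

  record Extends (A B : List (Fin (k G))) : Set where
    constructor extends
    field
      base  : Clique A
      extra : Clique B
      cross : All (λ b → All (Near b) A) B

  extends-∷ : ∀ {A b B} → Extends A (b ∷ B) → Extends (b ∷ A) B
  extends-∷ (extends c (n ∷ ns) (x ∷ xs)) =
    extends (x ∷ c) ns (All.zipWith (λ (bb' , nears) → trans (position-sym _ _) bb' ∷ nears) (n , xs))

  extends-drop : ∀ {A b B} → Extends A (b ∷ B) → Extends A B
  extends-drop (extends c (_ ∷ ns) (_ ∷ xs)) = extends c ns xs

  -- Tops after a turn

  turn-near : ∀ {v u} j P → position v u ≡ near → turn v j P u ≡ P u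
  turn-near {v} {u} j P eq rewrite eq = trans (place-near (residue v j P) _) (unplace-near (top (P v)) (P u))

  top-turn : ∀ v j P → residue v j P ≢ 0 → top (turn v j P v) ≡ residue v j P
  top-turn v j P nonzero rewrite position-refl v with (top (P v) + j) % N G v
  ... | zero  = contradiction refl nonzero
  ... | suc _ = refl

  top-turn-far : ∀ {v u} j P → residue v j P ≢ 0 → position v u ≡ far → top (turn v j P u) ≡ 0
  top-turn-far {v} j P nonzero eq rewrite eq with (top (P v) + j) % N G v
  ... | zero  = contradiction refl nonzero
  ... | suc _ = refl

  near? : ∀ v a → Dec (Near v a)
  near? v a = position v a ≟ᴾ near

  -- A nonzero residue leaves a marker on every stack far from `v`, so of the old top vertices only
  -- those near to `v` stay visible. If `v` was in `s`, the filter drops that copy, as it is `same`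
  -- and not `near`.
  turn-support : ∀ {v s} j P → (∀ u → u ∉ s → top (P u) ≡ 0) → residue v j P ≢ 0 →
    ∀ u → u ∉ v ∷ filter (near? v) s → top (turn v j P u) ≡ 0
  turn-support {v} {s} j P support nonzero u u∉ = by-position (position v u) refl
    where
    by-position : ∀ q → position v u ≡ q → top (turn v j P u) ≡ 0
    by-position same eq = contradiction (here (sym (same⇒≡ eq))) u∉
    by-position near eq = trans (cong top (turn-near j P eq))
                            (support u (λ u∈ → u∉ (there (∈-filter⁺ (near? v) u∈ eq))))
    by-position far  eq = top-turn-far j P nonzero eq

-- Equivalent graphs

module _ (G G' : NumberedGraph) (equiv : Equivalent G G') where

  SameN : Fin (k G) → Fin (k G') → Set
  SameN v v' = N G v ≡ N G' v'

  clique-multiset : ∀ {A A'} → Pointwise SameN A A' → Clique G A → Clique G' A' →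
    SameNMultiset G (vertexSet G A) G' (vertexSet G' A')
  clique-multiset [] _ _ m = trans (trans (mult-vertexSet G [] m) (sum-replicate-zero (k G)))
    (sym (trans (mult-vertexSet G' [] m) (sum-replicate-zero (k G'))))
  clique-multiset (eq ∷ eqs) (n ∷ c) (n' ∷ c') m = trans (mult-∷ G m n)
    (trans (cong₂ (λ x y → indicator (x ≡ᵇ m) + y) eq (clique-multiset eqs c c' m)) (sym (mult-∷ G' m n')))

  -- Vertices near to b are counted with b moved into A, and b itself is the only one in position
  -- same, so the count of the vertices far from b is a difference of known counts.
  hits-≡ : ∀ {A A' B B'} → Pointwise SameN A A' → Pointwise SameN B B' → Extends G A B → Extends G' A' B' →
    ∀ m p → sum (hits G A B m p) ≡ sum (hits G' A' B' m p)
  hits-≡ {A} {A'} eqA [] ext ext' m [] = trans (hits-[] G A m) (trans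
    (proj₂ equiv (vertexSet G A) (vertexSet G' A') (clique-isClique G (base ext)) (clique-isClique G' (base ext'))
      (clique-multiset eqA (base ext) (base ext')) m)
    (sym (hits-[] G' A' m)))
    where open Extends
  hits-≡ {A} {A'} eqA [] ext ext' m (q ∷ p) = trans (hits-mismatch G A [] m (q ∷ p) (λ _ ()))
    (sym (hits-mismatch G' A' [] m (q ∷ p) (λ _ ())))
  hits-≡ {A} {A'} {b ∷ B} {b' ∷ B'} eqA (eq ∷ eqs) ext ext' m [] =
    trans (hits-mismatch G A (b ∷ B) m [] (λ _ ())) (sym (hits-mismatch G' A' (b' ∷ B') m [] (λ _ ())))
  hits-≡ {A} {A'} {b ∷ B} {b' ∷ B'} eqA (eq ∷ eqs) ext ext' m (q ∷ p) = by-position q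
    where
    same-≡ : sum (hits G A (b ∷ B) m (same ∷ p)) ≡ sum (hits G' A' (b' ∷ B') m (same ∷ p))
    same-≡ = trans (hits-same G A b B m p (All.head (cross ext)) (AllPairs.head (extra ext)))
      (trans (cong₂ (λ n l → indicator ((n ≡ᵇ m) ∧ does (≡-dec _≟ᴾ_ (replicate l near) p))) eq (Pointwise-length eqs))
        (sym (hits-same G' A' b' B' m p (All.head (cross ext')) (AllPairs.head (extra ext')))))
      where open Extends
    near-≡ : sum (hits G A (b ∷ B) m (near ∷ p)) ≡ sum (hits G' A' (b' ∷ B') m (near ∷ p))
    near-≡ = trans (hits-near G A b B m p)
      (trans (hits-≡ (eq ∷ eqA) eqs (extends-∷ G ext) (extends-∷ G' ext') m p) (sym (hits-near G' A' b' B' m p)))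
    total : sum (hits G A B m p) ≡ sum (hits G' A' B' m p)
    total = hits-≡ eqA eqs (extends-drop G ext) (extends-drop G' ext') m p
    by-position : ∀ q → sum (hits G A (b ∷ B) m (q ∷ p)) ≡ sum (hits G' A' (b' ∷ B') m (q ∷ p))
    by-position same = same-≡
    by-position near = near-≡
    by-position far  = +-cancelˡ-≡ (sum (hits G A (b ∷ B) m (near ∷ p))) _ _
      (+-cancelˡ-≡ (sum (hits G A (b ∷ B) m (same ∷ p))) _ _
        (trans (sym (hits-split G A b B m p)) (trans total (trans (hits-split G' A' b' B' m p)
          (sym (cong₂ (λ s n → s + (n + _)) same-≡ near-≡))))))

  -- A simulation relation that sees the tops only. Both cliques are listed in a common order, which
  -- makes traces on them comparable.
  record Matched (P : Piling G) (P' : Piling G') : Set where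
    field
      {clique}   : List (Fin (k G))
      {clique'}  : List (Fin (k G'))
      adjacent   : Clique G clique
      adjacent'  : Clique G' clique'
      agree      : Pointwise (λ a a' → SameN a a' × top (P a) ≡ top (P' a')) clique clique'
      support    : ∀ v → v ∉ clique → top (P v) ≡ 0
      support'   : ∀ v → v ∉ clique' → top (P' v) ≡ 0

  ground-matched : Matched (ground G) (ground G')
  ground-matched = record
    { adjacent = [] ; adjacent' = [] ; agree = [] ; support = λ _ _ → refl ; support' = λ _ _ → refl }

  module _ {P P'} (M : Matched P P') where
    open Matched M

    key : Fin (k G) → ℕ × List Position
    key v = N G v , trace G clique v

    key' : Fin (k G') → ℕ × List Position
    key' v = N G' v , trace G' clique' v

    _≟ᴷ_ : DecidableEquality (ℕ × List Position)
    (m , p) ≟ᴷ (n , q) = map′ ×-≡,≡→≡ ×-≡,≡←≡ ((m ℕ.≟ n) ×-dec ≡-dec _≟ᴾ_ p q)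

    fibres-≡ : fibreSize _≟ᴷ_ key ≗ fibreSize _≟ᴷ_ key'
    -- With an empty first list `hits` unfolds to the indicator of a fibre, so these counts are
    -- fibre sizes by definition.
    fibres-≡ (m , p) = hits-≡ [] (Pointwise.map proj₁ agree)
      (extends [] adjacent (All.universal (λ _ → []) _)) (extends [] adjacent' (All.universal (λ _ → []) _)) m p

    -- An entry `same` in the trace identifies `v` with a listed vertex, whose top agrees with that
    -- of its partner. Without such an entry both vertices lie off the cliques and both tops are 0.
    top-≡ : ∀ v v' → trace G clique v ≡ trace G' clique' v' → top (P v) ≡ top (P' v')
    top-≡ v v' eq with locate agree eq
      where
      locate : ∀ {s s'} → Pointwise (λ a a' → SameN a a' × top (P a) ≡ top (P' a')) s s' →
        trace G s v ≡ trace G' s' v' → top (P v) ≡ top (P' v') ⊎ (v ∉ s × v' ∉ s')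
      locate [] eq = inj₂ ((λ ()) , (λ ()))
      locate {a ∷ s} {a' ∷ s'} ((_ , tops) ∷ agree) eq
        with position G v a ≟ᴾ same | locate agree (∷-injectiveʳ eq)
      ... | yes on  | _ = inj₁ (trans (cong (top ∘ P) (same⇒≡ G on))
              (trans tops (cong (top ∘ P') (sym (same⇒≡ G' (trans (sym (∷-injectiveˡ eq)) on))))))
      ... | no _    | inj₁ found = inj₁ found
      ... | no off  | inj₂ (v∉ , v'∉) = inj₂
              ( (λ { (here refl) → off (position-refl G v) ; (there v∈) → v∉ v∈ })
              , (λ { (here refl) → off (trans (∷-injectiveˡ eq) (position-refl G' v')) ; (there v∈) → v'∉ v∈ }))
    ... | inj₁ tops       = tops
    ... | inj₂ (v∉ , v'∉) = trans (support v v∉) (sym (support' v' v'∉))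

    -- Equal traces make the two filters keep the same places of the lists, so the surviving pairs
    -- stay paired with unchanged tops. The new heads share a number by the key and a top by the
    -- residues.
    turn-matched : ∀ {v v'} j j' → key v ≡ key' v' →
      residue G v j P ≡ residue G' v' j' P' → residue G v j P ≢ 0 →
      Matched (turn G v j P) (turn G' v' j' P')
    turn-matched {v} {v'} j j' same-key res≡ nonzero = record
      { adjacent  = All.all-filter (near? G v) clique ∷ AllPairs.filter⁺ (near? G v) adjacent
      ; adjacent' = All.all-filter (near? G' v') clique' ∷ AllPairs.filter⁺ (near? G' v') adjacent'
      ; agree     = (cong proj₁ same-key , trans (top-turn G v j P nonzero)
                      (trans res≡ (sym (top-turn G' v' j' P' nonzero'))))
                    ∷ filtered agree (cong proj₂ same-key)
      ; support   = turn-support G j P support nonzero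
      ; support'  = turn-support G' j' P' support' nonzero'
      }
      where
      nonzero' : residue G' v' j' P' ≢ 0
      nonzero' = nonzero ∘ trans res≡
      filtered : ∀ {s s'} → Pointwise (λ a a' → SameN a a' × top (P a) ≡ top (P' a')) s s' →
        trace G s v ≡ trace G' s' v' →
        Pointwise (λ a a' → SameN a a' × top (turn G v j P a) ≡ top (turn G' v' j' P' a'))
          (filter (near? G v) s) (filter (near? G' v') s')
      filtered [] eq = []
      filtered {a ∷ s} {a' ∷ s'} ((n≡ , tops) ∷ agree) eq with near? G v a | near? G' v' a'
      ... | yes nr | yes nr' = (n≡ , trans (cong top (turn-near G j P nr))
                                 (trans tops (cong top (sym (turn-near G' j' P' nr')))))
                               ∷ filtered agree (∷-injectiveʳ eq)
      ... | no _   | no _    = filtered agree (∷-injectiveʳ eq)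
      ... | yes nr | no ¬nr' = contradiction (trans (sym (∷-injectiveˡ eq)) nr) ¬nr'
      ... | no ¬nr | yes nr' = contradiction (trans (∷-injectiveˡ eq) nr') ¬nr

  -- Grouped by first vertex, the count is a sum whose terms depend on the key alone. The induction
  -- hypothesis is called only for raising letters, whose residue is nonzero as `turn-matched`
  -- requires.
  accepted-≡ : ∀ n {P P'} → Matched P P' → length (accepted G n P) ≡ length (accepted G' n P')
  accepted-≡ zero    M = refl
  accepted-≡ (suc n) {P} {P'} M = begin
    length (accepted G (suc n) P)                ≡⟨ length-concatMap-tabulate (acceptedAt G n P) id ⟩
    sum (λ v → length (acceptedAt G n P v))
      ≡⟨ sum-transport (_≟ᴷ_ M) (key M) (key' M) (fibres-≡ M) at-≡ ⟩
    sum (λ v → length (acceptedAt G' n P' v))    ≡⟨ length-concatMap-tabulate (acceptedAt G' n P') id ⟨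
    length (accepted G' (suc n) P')              ∎
    where
    open ≡-Reasoning
    via-≡ : ∀ l l' → key M (vertex G l) ≡ key' M (vertex G' l') → exponentOf G l ≡ exponentOf G' l' →
      length (acceptedVia G n P l) ≡ length (acceptedVia G' n P' l')
    via-≡ l l' same-key exp≡ = length-keepIf (raises? G P l) (raises? G' P' l')
        (λ raises → trans (sym raised≡) (trans raises (cong suc cost≡)))
        (λ raises → trans raised≡ (trans raises (cong suc (sym cost≡))))
        (λ raises → trans (length-map (l ∷_) (accepted G n (act G l P)))
          (trans (accepted-≡ n (turn-matched M _ _ same-key res≡ (raised-nonzero raises)))
                 (sym (length-map (l' ∷_) (accepted G' n (act G' l' P'))))))
      where
      N≡ : N G (vertex G l) ≡ N G' (vertex G' l')
      N≡ = cong proj₁ same-key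
      tops : top (P (vertex G l)) ≡ top (P' (vertex G' l'))
      tops = top-≡ M _ _ (cong proj₂ same-key)
      res≡ : residue G (vertex G l) (exponentOf G l) P ≡ residue G' (vertex G' l') (exponentOf G' l') P'
      res≡ = %-cong ⦃ N-nonZero G ⦄ ⦃ N-nonZero G' ⦄ (cong₂ _+_ tops exp≡) N≡
      raised≡ : cost (N G (vertex G l)) (residue G (vertex G l) (exponentOf G l) P) ≡
                cost (N G' (vertex G' l')) (residue G' (vertex G' l') (exponentOf G' l') P')
      raised≡ = cong₂ cost N≡ res≡
      cost≡ : topCost G (vertex G l) P ≡ topCost G' (vertex G' l') P'
      cost≡ = cong₂ cost N≡ tops
      raised-nonzero : Raises G P l → residue G (vertex G l) (exponentOf G l) P ≢ 0
      raised-nonzero raises res≡0 with () ← trans (sym raises) (cong (cost (N G (vertex G l))) res≡0)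
    inverses-≡ : ∀ {v v'} d d' → key M v ≡ key' M v' →
      length (concatMap (acceptedVia G n P) (inversesIf G v d)) ≡
      length (concatMap (acceptedVia G' n P') (inversesIf G' v' d'))
    inverses-≡ {v} {v'} (yes p) (yes p') same-key = trans (cong length (++-identityʳ (acceptedVia G n P (neg v p))))
      (trans (via-≡ (neg v p) (neg v' p') same-key (cong (λ κ → proj₁ κ ∸ 1) same-key))
             (sym (cong length (++-identityʳ (acceptedVia G' n P' (neg v' p'))))))
    -- Whether an inverse letter exists is decided by the number of the vertex, which is part of the
    -- key.
    inverses-≡ (yes p) (no ¬p') same-key = contradiction (subst (λ κ → T (not (proj₁ κ ≡ᵇ 2))) same-key p) ¬p'
    inverses-≡ (no ¬p) (yes p') same-key = contradiction (subst (λ κ → T (not (proj₁ κ ≡ᵇ 2))) (sym same-key) p') ¬p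
    inverses-≡ (no _)  (no _)   same-key = refl
    at-≡ : ∀ v v' → key M v ≡ key' M v' → length (acceptedAt G n P v) ≡ length (acceptedAt G' n P' v')
    at-≡ v v' same-key = trans (length-++ (acceptedVia G n P (pos v)))
      (trans (cong₂ _+_ (via-≡ (pos v) (pos v') same-key refl) (inverses-≡ (T? _) (T? _) same-key))
             (sym (length-++ (acceptedVia G' n P' (pos v')))))

theorem5p14 : (G G' : NumberedGraph) → LinkRegular G → LinkRegular G' →
    Equivalent G G' → SameGeodesicGrowth G G'
theorem5p14 G G' _ _ equiv n L L' enum enum' =
  trans (geodesic-count G n L enum)
    (trans (accepted-≡ G G' equiv n (ground-matched G G' equiv)) (sym (geodesic-count G' n L' enum')))
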